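{- Let $A\in\mathcal{PM}(n)$ have row vectors $r_0,\ldots,r_{n-1}$. A poset vector $v$ of $A$ is join-irreducible if and only if $v=r_i$ for some $i\in X_n$.
   Context: Let $X_n=\{0,1,\ldots,n-1\}$. A naturally labeled (NL) poset on $X_n$ is a partial order $\preceq$ on $X_n$ such that $x\preceq y$ implies $x\le y$ in the usual integer order. Its poset matrix is the $n\times n$ $(0,1)$-matrix $A=(a_{i,j})_{i,j\in X_n}$ with $a_{i,j}=1$ if $j\preceq i$ and $0$ otherwise; $\mathcal{PM}(n)$ is the set of all such matrices. Arithmetic is Boolean ($1+1=1$, vector sum entrywise). For $v\in\{0,1\}^n$, $A^v=\begin{bmatrix}A&\mathbf{0}\\ v&1\end{bmatrix}$, and $v$ is a poset vector of $A$ if $A^v\in\mathcal{PM}(n+1)$. A poset vector $v$ is join-irreducible if $v\neq\mathbf 0$ and, whenever $v=u+w$ with $u,w$ poset vectors of $A$, one has $v=u$ or $v=w$. -}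

module Defs where

open import Data.Bool.Base using (Bool; true; false; _∨_)
open import Data.Fin.Base using (Fin; _≤_)
open import Data.Nat.Base using (ℕ; suc)
open import Data.Product.Base using (Σ-syntax; _×_)
open import Data.Sum.Base using (_⊎_)
open import Data.Vec.Base using (Vec; lookup; map; replicate; zipWith; _∷ʳ_)
open import Level using (0ℓ) renaming (suc to lsuc)
open import Relation.Binary.Core using (Rel)
open import Relation.Binary.PropositionalEquality.Core using (_≡_; _≢_)
open import Relation.Binary.Structures using (IsPartialOrder)
open import Relation.Nullary.Reflects using (Reflects)

-- X_n is Fin n; the Boolean semiring {0,1} is Bool with 0 = false,
-- 1 = true and addition _∨_.

record NLPoset (n : ℕ) : Set (lsuc 0ℓ) where
  field
    _≼_            : Rel (Fin n) 0ℓ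
    isPartialOrder : IsPartialOrder _≡_ _≼_
    natural        : ∀ {x y} → x ≼ y → x ≤ y

BVec : ℕ → Set
BVec n = Vec Bool n

BMatrix : ℕ → Set
BMatrix n = Vec (BVec n) n

row : ∀ {n} → BMatrix n → Fin n → BVec n
row A i = lookup A i

entry : ∀ {n} → BMatrix n → Fin n → Fin n → Bool
entry A i j = lookup (row A i) j

_IsMatrixOf_ : ∀ {n} → BMatrix n → NLPoset n → Set
A IsMatrixOf P = ∀ i j → Reflects (j ≼ i) (entry A i j)
  where open NLPoset P

-- Membership in 𝒫ℳ(n).
PosetMatrix : ∀ {n} → BMatrix n → Set (lsuc 0ℓ)
PosetMatrix {n} A = Σ[ P ∈ NLPoset n ] A IsMatrixOf P

𝟎 : ∀ {n} → BVec n
𝟎 {n} = replicate n false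

infixl 6 _⊕_
_⊕_ : ∀ {n} → BVec n → BVec n → BVec n
_⊕_ = zipWith _∨_

-- The block matrix  [ A 0 ; v 1 ].
extend : ∀ {n} → BMatrix n → BVec n → BMatrix (suc n)
extend A v = map (_∷ʳ false) A ∷ʳ (v ∷ʳ true)

PosetVector : ∀ {n} → BMatrix n → BVec n → Set (lsuc 0ℓ)
PosetVector A v = PosetMatrix (extend A v)

JoinIrreducible : ∀ {n} → BMatrix n → BVec n → Set (lsuc 0ℓ)
JoinIrreducible A v =
  v ≢ 𝟎 ×
  (∀ u w → PosetVector A u → PosetVector A w → v ≡ u ⊕ w → v ≡ u ⊎ v ≡ w)

{-# OPTIONS --safe #-}
module Submission where

-- Poset vectors of A are the indicator vectors of down-sets, and rᵢ is the principal down-set of i.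
-- If rᵢ = u + w then i lies in u or in w, and that down-set then contains all of rᵢ.
-- Conversely, if i is the greatest label in a nonzero poset vector v, then i is maximal in v, so
-- v with i removed is again a down-set and v = rᵢ + (v - i); as v ≠ v - i, irreducibility gives v = rᵢ.

open import Defs
open import Data.Bool.Base using (true; false)
open import Data.Fin.Base using (Fin; zero; suc; _≤_; fromℕ; inject₁)
open import Data.Fin.Properties using (_≟_; ≤-antisym; ≤fromℕ; toℕ-inject₁)
open import Data.Fin.Relation.Unary.Top using (view; ‵fromℕ; ‵inject₁)
open import Data.Fin.Subset using (Subset; _∈_; _∉_; _⊆_; _∪_; _-_; Nonempty)
open import Data.Fin.Subset.Properties using (∉⊥; nonempty?; Empty-unique; ⊆-antisym; x∈p∪q⁻; p⊆p∪q; q⊆p∪q; x∈p∧x≢y⇒x∈p-y; p─q⊆p)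
open import Data.Nat.Base using (ℕ; z≤n; s≤s)
open import Data.Product.Base using (∃-syntax; _×_; _,_)
open import Data.Sum.Base as Sum using (inj₁; inj₂; [_,_]′)
open import Data.Vec.Base using (Vec; []; _∷_; _∷ʳ_; here; there; lookup; map)
open import Data.Vec.Properties using ([]=⇒lookup; lookup⇒[]=; lookup-map)
open import Function.Base using (_∘_)
open import Function.Bundles using (_⇔_; mk⇔)
open import Relation.Binary.PropositionalEquality.Core using (_≡_; refl; sym; trans; subst)
open import Relation.Binary.PropositionalEquality.Properties using (isEquivalence)
open import Relation.Binary.Structures using (IsPartialOrder)
open import Relation.Nullary.Decidable.Core using (yes; no)
open import Relation.Nullary.Negation.Core using (contradiction)
open import Relation.Nullary.Reflects using (Reflects; ofʸ; ofⁿ)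

private variable
  n : ℕ

lookup-∷ʳ-inject₁ : ∀ {a} {X : Set a} (xs : Vec X n) x i → lookup (xs ∷ʳ x) (inject₁ i) ≡ lookup xs i
lookup-∷ʳ-inject₁ (_ ∷ _)  x zero    = refl
lookup-∷ʳ-inject₁ (_ ∷ xs) x (suc i) = lookup-∷ʳ-inject₁ xs x i

lookup-∷ʳ-fromℕ : ∀ {a} {X : Set a} (xs : Vec X n) x → lookup (xs ∷ʳ x) (fromℕ n) ≡ x
lookup-∷ʳ-fromℕ []       x = refl
lookup-∷ʳ-fromℕ (_ ∷ xs) x = lookup-∷ʳ-fromℕ xs x

-- A Boolean vector is definitionally a Data.Fin.Subset, with 𝟎 and _⊕_ being ⊥ and _∪_.

∈-∷ʳ⁺ : ∀ {p : Subset n} {i b} → i ∈ p → inject₁ i ∈ p ∷ʳ b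
∈-∷ʳ⁺ here        = here
∈-∷ʳ⁺ (there i∈p) = there (∈-∷ʳ⁺ i∈p)

∈-∷ʳ⁻ : ∀ (p : Subset n) i {b} → inject₁ i ∈ p ∷ʳ b → i ∈ p
∈-∷ʳ⁻ (_ ∷ p) zero    here        = here
∈-∷ʳ⁻ (_ ∷ p) (suc i) (there i∈p) = there (∈-∷ʳ⁻ p i i∈p)

x∉p-x : ∀ (p : Subset n) x → x ∉ p - x
-- No clause for `zero` is needed: the head of `p - zero` computes to `false`, so `here` cannot
-- inhabit the membership.
x∉p-x (_ ∷ p) (suc x) (there x∈) = x∉p-x p x x∈

-- The tail is searched first, since every label in it exceeds `zero`; `zero` is the answer only
-- when the tail is empty.
greatest : (p : Subset n) → Nonempty p → ∃[ i ] i ∈ p × (∀ {j} → j ∈ p → j ≤ i)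
greatest (b ∷ p) ne with nonempty? p
... | yes p≢∅ = let i , i∈p , max = greatest p p≢∅ in
  suc i , there i∈p , λ { here → z≤n ; (there j∈p) → s≤s (max j∈p) }
greatest (_ ∷ p) (zero  , here)      | no ¬ne = zero , here , λ
  { here → z≤n ; (there j∈p) → contradiction (_ , j∈p) ¬ne }
greatest (_ ∷ p) (suc i , there i∈p) | no ¬ne = contradiction (i , i∈p) ¬ne

-- Antisymmetry of the order is implied by naturality.
record IsNatural (A : BMatrix n) : Set where
  field
    reflexive  : ∀ i → i ∈ row A i
    triangular : ∀ {i j} → j ∈ row A i → j ≤ i
    transitive : ∀ {i j k} → j ∈ row A i → k ∈ row A j → k ∈ row A i

reflects⁺ : ∀ {P : Set} {b} → Reflects P b → P → b ≡ true
reflects⁺ (ofʸ _)  _ = refl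
reflects⁺ (ofⁿ ¬p) p = contradiction p ¬p

reflects⁻ : ∀ {P : Set} {b} → Reflects P b → b ≡ true → P
reflects⁻ (ofʸ p) _ = p

∈-reflects : ∀ (p : Subset n) i → Reflects (i ∈ p) (lookup p i)
∈-reflects p i with lookup p i in eq
... | true  = ofʸ (lookup⇒[]= i p eq)
... | false = ofⁿ λ i∈p → contradiction (trans (sym eq) ([]=⇒lookup i∈p)) λ ()

posetMatrix⇒isNatural : (A : BMatrix n) → PosetMatrix A → IsNatural A
posetMatrix⇒isNatural A (P , A≈P) = record
  { reflexive  = λ i → to P.refl
  ; triangular = natural ∘ from
  ; transitive = λ j∈i k∈j → to (P.trans (from k∈j) (from j∈i))
  }
  where
  open NLPoset P
  module P = IsPartialOrder isPartialOrder
  to : ∀ {i j} → j ≼ i → j ∈ row A i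
  to j≼i = lookup⇒[]= _ _ (reflects⁺ (A≈P _ _) j≼i)
  from : ∀ {i j} → j ∈ row A i → j ≼ i
  from j∈i = reflects⁻ (A≈P _ _) ([]=⇒lookup j∈i)

isNatural⇒posetMatrix : (A : BMatrix n) → IsNatural A → PosetMatrix A
isNatural⇒posetMatrix A nat = record
  { _≼_            = λ j i → j ∈ row A i
  ; isPartialOrder = record
    { isPreorder = record
      { isEquivalence = isEquivalence
      ; reflexive     = λ { refl → reflexive _ }
      -- The arguments swap because `transitive` descends from the top row, whereas a chain for the
      -- order is composed from the bottom.
      ; trans         = λ k∈j j∈i → transitive j∈i k∈j
      }
    ; antisym = λ j∈i i∈j → ≤-antisym (triangular j∈i) (triangular i∈j)
    }
  ; natural        = triangular
  } , λ i j → ∈-reflects (row A i) j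
  where open IsNatural nat

IsDownSet : BMatrix n → BVec n → Set
IsDownSet A v = ∀ {i j} → i ∈ v → j ∈ row A i → j ∈ v

module _ (A : BMatrix n) (v : BVec n) where

  row-extend-inject₁ : ∀ i → row (extend A v) (inject₁ i) ≡ row A i ∷ʳ false
  row-extend-inject₁ i = trans (lookup-∷ʳ-inject₁ (map (_∷ʳ false) A) (v ∷ʳ true) i) (lookup-map i (_∷ʳ false) A)

  row-extend-fromℕ : row (extend A v) (fromℕ n) ≡ v ∷ʳ true
  row-extend-fromℕ = lookup-∷ʳ-fromℕ (map (_∷ʳ false) A) (v ∷ʳ true)

  -- From here on the four blocks of `extend A v` are handled only through membership, with old
  -- labels as `inject₁` and the new one as `fromℕ n`.
  ∈-old⁺ : ∀ {i j} → j ∈ row A i → inject₁ j ∈ row (extend A v) (inject₁ i)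
  ∈-old⁺ {i} j∈i = subst (_ ∈_) (sym (row-extend-inject₁ i)) (∈-∷ʳ⁺ j∈i)

  ∈-old⁻ : ∀ i j → inject₁ j ∈ row (extend A v) (inject₁ i) → j ∈ row A i
  ∈-old⁻ i j j∈i = ∈-∷ʳ⁻ _ j (subst (_ ∈_) (row-extend-inject₁ i) j∈i)

  ∈-new⁺ : ∀ {j} → j ∈ v → inject₁ j ∈ row (extend A v) (fromℕ n)
  ∈-new⁺ j∈v = subst (_ ∈_) (sym row-extend-fromℕ) (∈-∷ʳ⁺ j∈v)

  ∈-new⁻ : ∀ j → inject₁ j ∈ row (extend A v) (fromℕ n) → j ∈ v
  ∈-new⁻ j j∈v = ∈-∷ʳ⁻ _ j (subst (_ ∈_) row-extend-fromℕ j∈v)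

  new∈new : fromℕ n ∈ row (extend A v) (fromℕ n)
  new∈new = subst (_ ∈_) (sym row-extend-fromℕ) (lookup⇒[]= _ _ (lookup-∷ʳ-fromℕ v true))

  new∉old : ∀ i → fromℕ n ∉ row (extend A v) (inject₁ i)
  new∉old i new∈i
    with () ← trans (sym (lookup-∷ʳ-fromℕ (row A i) false))
                    ([]=⇒lookup (subst (_ ∈_) (row-extend-inject₁ i) new∈i))

-- Closure of `v` is transitivity of the extended matrix along chains that start at the new row and
-- continue through old labels.
posetVector⇒isDownSet : ∀ (A : BMatrix n) v → PosetVector A v → IsDownSet A v
posetVector⇒isDownSet A v pv i∈v j∈i =
  ∈-new⁻ A v _ (IsNatural.transitive (posetMatrix⇒isNatural (extend A v) pv) (∈-new⁺ A v i∈v) (∈-old⁺ A v j∈i))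

isDownSet⇒posetVector : ∀ {A : BMatrix n} {v} → IsNatural A → IsDownSet A v → PosetVector A v
isDownSet⇒posetVector {n} {A} {v} nat down = isNatural⇒posetMatrix (extend A v) record
  { reflexive  = refl′
  ; triangular = λ {i} {j} → tri i j
  ; transitive = λ {i} {j} {k} → trans′ i j k
  }
  where
  open IsNatural nat
  B = extend A v

  refl′ : ∀ i → i ∈ row B i
  refl′ i with view i
  ... | ‵fromℕ     = new∈new A v
  ... | ‵inject₁ i = ∈-old⁺ A v (reflexive i)

  tri : ∀ i j → j ∈ row B i → j ≤ i
  tri i j j∈i with view i | view j
  ... | ‵fromℕ     | _          = ≤fromℕ j
  ... | ‵inject₁ i | ‵fromℕ     = contradiction j∈i (new∉old A v i)
  ... | ‵inject₁ i | ‵inject₁ j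
    -- `inject₁` keeps the numerical value, so the inequality is the one already known for `A`.
    rewrite toℕ-inject₁ i | toℕ-inject₁ j = triangular (∈-old⁻ A v i j j∈i)

  trans′ : ∀ i j k → j ∈ row B i → k ∈ row B j → k ∈ row B i
  trans′ i j k j∈i k∈j with view i | view j | view k
  -- The new label lies below no old label, which rules out this case and the next.
  ... | _          | ‵inject₁ j | ‵fromℕ     = contradiction k∈j (new∉old A v j)
  ... | ‵inject₁ i | ‵fromℕ     | _          = contradiction j∈i (new∉old A v i)
  ... | ‵fromℕ     | ‵fromℕ     | _          = k∈j
  -- The only case that calls on closure of `v`: a chain from the new label down through two old
  -- ones.
  ... | ‵fromℕ     | ‵inject₁ j | ‵inject₁ k =
    ∈-new⁺ A v (down (∈-new⁻ A v j j∈i) (∈-old⁻ A v j k k∈j))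
  ... | ‵inject₁ i | ‵inject₁ j | ‵inject₁ k =
    ∈-old⁺ A v (transitive (∈-old⁻ A v i j j∈i) (∈-old⁻ A v j k k∈j))

module _ {A : BMatrix n} (nat : IsNatural A) where
  open IsNatural nat

  row-isDownSet : ∀ i → IsDownSet A (row A i)
  row-isDownSet i = transitive

  remove-greatest-isDownSet : ∀ {v i} → IsDownSet A v → (∀ {j} → j ∈ v → j ≤ i) → IsDownSet A (v - i)
  remove-greatest-isDownSet {v} {i} down max {j} {k} j∈v-i k∈j =
    -- If `k` were the removed label, then `j ≤ k` by maximality and `k ≤ j` by naturality, so `j`
    -- itself would have been removed.
    x∈p∧x≢y⇒x∈p-y (down j∈v k∈j) λ { refl →
      x∉p-x v k (subst (_∈ v - k) (≤-antisym (max j∈v) (triangular k∈j)) j∈v-i) }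
    where
    j∈v : j ∈ v
    j∈v = p─q⊆p v _ j∈v-i

  -- Reflexivity restores the removed `i` through its own row, and closure of `v` keeps that row
  -- inside `v`.
  decompose : ∀ {v i} → IsDownSet A v → i ∈ v → v ≡ row A i ⊕ (v - i)
  decompose {v} {i} down i∈v = ⊆-antisym to from
    where
    to : v ⊆ row A i ∪ (v - i)
    to {j} j∈v with j ≟ i
    ... | yes refl = p⊆p∪q (v - i) (reflexive j)
    ... | no  j≢i  = q⊆p∪q (row A i) (v - i) (x∈p∧x≢y⇒x∈p-y j∈v j≢i)
    from : row A i ∪ (v - i) ⊆ v
    from j∈ = [ down i∈v , p─q⊆p v _ ]′ (x∈p∪q⁻ (row A i) (v - i) j∈)

  joinIrreducible⇒row : ∀ {v} → IsDownSet A v → JoinIrreducible A v → ∃[ i ] v ≡ row A i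
  joinIrreducible⇒row {v} down (v≢𝟎 , irr) with nonempty? v
  -- An empty subset is `𝟎`, which join-irreducibility excludes; otherwise a greatest label exists.
  ... | no  ¬ne = contradiction (Empty-unique ¬ne) v≢𝟎
  ... | yes ne with i , i∈v , max ← greatest v ne
    with irr (row A i) (v - i)
           (isDownSet⇒posetVector nat (row-isDownSet i))
           (isDownSet⇒posetVector nat (remove-greatest-isDownSet down max))
           (decompose down i∈v)
  ... | inj₁ v≡rᵢ  = i , v≡rᵢ
  ... | inj₂ v≡v-i = contradiction (subst (i ∈_) v≡v-i i∈v) (x∉p-x v i)

  row-joinIrreducible : ∀ i → JoinIrreducible A (row A i)
  row-joinIrreducible i =
    (λ rᵢ≡𝟎 → ∉⊥ (subst (i ∈_) rᵢ≡𝟎 (reflexive i))) ,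
    λ u w pu pw rᵢ≡u⊕w →
      -- Each summand lies inside the row; the one containing `i` also contains the row, so the two
      -- coincide.
      let below : ∀ {p} → p ⊆ u ∪ w → p ⊆ row A i
          below p⊆ = subst (_ ∈_) (sym rᵢ≡u⊕w) ∘ p⊆
      in Sum.map
        (λ i∈u → ⊆-antisym (posetVector⇒isDownSet A u pu i∈u) (below (p⊆p∪q w)))
        (λ i∈w → ⊆-antisym (posetVector⇒isDownSet A w pw i∈w) (below (q⊆p∪q u w)))
        (x∈p∪q⁻ u w (subst (i ∈_) rᵢ≡u⊕w (reflexive i)))

theorem5p5 : (n : ℕ) (A : BMatrix n) → PosetMatrix A →
    (v : BVec n) → PosetVector A v →
    JoinIrreducible A v ⇔ (∃[ i ] v ≡ row A i)
theorem5p5 n A pm v pv = mk⇔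
  (joinIrreducible⇒row nat (posetVector⇒isDownSet A v pv))
  λ { (i , refl) → row-joinIrreducible nat i }
  where
  nat : IsNatural A
  nat = posetMatrix⇒isNatural A pm
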